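{- Let $\models$ be an intersective mixed consequence truth-relation on a finite set $V$ of truth values, with induced consequence relation $\vdash$ in a constant expressive setting. The following are equivalent: (i) $\vdash$ admits a G-conjunction; (ii) every minimal representation of $\models$ is based on a conjunction-compatible list of sets of designated values; (iii) some representation of $\models$ is based on a conjunction-compatible list of sets of designated values.
   Context: $V$ contains distinct $1,0$; sets of designated values: $\mathcal{D}\subseteq V$, $1\in\mathcal{D}$, $0\notin\mathcal{D}$. $\gamma\models_{\mathcal{D}_p,\mathcal{D}_c}\delta$ iff ($\gamma\subseteq\mathcal{D}_p\Rightarrow\delta\cap\mathcal{D}_c\neq\emptyset$). An intersective mixed truth-relation is $\models_{\mathcal{D}_p^1,\mathcal{D}_c^1}\cap\dots\cap\models_{\mathcal{D}_p^K,\mathcal{D}_c^K}$; such a list is a representation, based on the list of sets $\mathcal{D}_p^1,\mathcal{D}_c^1,\dots,\mathcal{D}_p^K,\mathcal{D}_c^K$; it is minimal if $K$ is least possible. A list $\mathcal{D}_1,\dots,\mathcal{D}_n$ is conjunction-compatible if for all $x,y\in V$ there is $z\in V$ such that for every $i$: $z\in\mathcal{D}_i$ iff ($x\in\mathcal{D}_i$ and $y\in\mathcal{D}_i$). Semantics: valuations mapping atoms to $V$, connectives interpreted by fixed truth functions, extended compositionally, every assignment to finitely many distinct atoms realized; constant expressive: every value is the constant value of some formula. $\Gamma\vdash\Delta$ iff $v(\Gamma)\models v(\Delta)$ for all $v$. A G-conjunction is a binary connective $\wedge$ (interpreted by some truth function) with, for all $\Gamma,\Delta,A,B$: $\Gamma\cup\{A\wedge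 B\}\vdash\Delta$ iff $\Gamma\cup\{A,B\}\vdash\Delta$; and $\Gamma\vdash\{A\wedge B\}\cup\Delta$ iff ($\Gamma\vdash\{A\}\cup\Delta$ and $\Gamma\vdash\{B\}\cup\Delta$). -}

module Defs where

open import Level using (0ℓ)
open import Data.Nat.Base using (ℕ; _≤_)
open import Data.Fin.Base using (Fin)
open import Data.Fin.Subset using (Subset) renaming (_∈_ to _∈ₛ_; _∉_ to _∉ₛ_)
open import Data.List.Base using (List; []; _∷_; concatMap)
open import Data.List.NonEmpty.Base using (List⁺; toList) renaming (length to length⁺)
open import Data.List.Relation.Unary.All using (All)
open import Data.Maybe.Base using (Maybe; just; nothing; maybe′)
open import Data.Product.Base using (Σ; ∃; _×_; _,_)
open import Data.Vec.Base using (Vec; []; _∷_)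
open import Function.Bundles using (_⇔_)
open import Function.Definitions using (Injective)
open import Relation.Binary.Core using (REL; Rel)
open import Relation.Binary.PropositionalEquality.Core using (_≡_)
open import Relation.Unary using (Pred; _∈_; _⊆_; _≬_; _∪_; ｛_｝)

-- The finite set V of truth values is Fin n.  Sets of designated values are
-- decidable subsets (Subset n), whereas truth-relations relate arbitrary sets
-- of truth values, since these arise as images of arbitrary sets of formulas.

TruthRelation : ℕ → Set₁
TruthRelation n = REL (Pred (Fin n) 0ℓ) (Pred (Fin n) 0ℓ) 0ℓ

mixed : ∀ {n} → Subset n × Subset n → TruthRelation n
mixed (Dₚ , D꜀) γ δ = γ ⊆ (_∈ₛ Dₚ) → δ ≬ (_∈ₛ D꜀)

ConjunctionCompatible : ∀ {n} → List (Subset n) → Set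
ConjunctionCompatible {n} Ds =
  (x y : Fin n) → ∃ λ z → All (λ D → z ∈ₛ D ⇔ (x ∈ₛ D × y ∈ₛ D)) Ds

module _ {n : ℕ} (𝟏 𝟎 : Fin n) where

  DesignatedSet : Pred (Subset n) 0ℓ
  DesignatedSet D = 𝟏 ∈ₛ D × 𝟎 ∉ₛ D

  -- The list is nonempty: an intersection of K ≥ 1 mixed truth-relations.
  record Representation (_⊨_ : TruthRelation n) : Set₁ where
    field
      pairs      : List⁺ (Subset n × Subset n)
      designated : All (λ (Dₚ , D꜀) → DesignatedSet Dₚ × DesignatedSet D꜀) (toList pairs)
      represents : ∀ γ δ → γ ⊨ δ ⇔ All (λ p → mixed p γ δ) (toList pairs)

    size : ℕ
    size = length⁺ pairs

    sets : List (Subset n)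
    sets = concatMap (λ (Dₚ , D꜀) → Dₚ ∷ D꜀ ∷ []) (toList pairs)

  open Representation public using (size; sets)

  IntersectiveMixed : TruthRelation n → Set₁
  IntersectiveMixed _⊨_ = Representation _⊨_

  Minimal : ∀ {_⊨_} → Representation _⊨_ → Set₁
  Minimal {_⊨_} R = (R′ : Representation _⊨_) → size R ≤ size R′

record Language : Set₁ where
  field
    Atom       : Set
    Connective : Set
    arity      : Connective → ℕ

data Formula (L : Language) : Set where
  atom : Language.Atom L → Formula L
  app  : (c : Language.Connective L) → Vec (Formula L) (Language.arity L c) → Formula L

record Semantics (L : Language) (n : ℕ) : Set₁ where
  open Language L
  field
    truthFunction : (c : Connective) → Vec (Fin n) (arity c) → Fin n
    Valuation     : Pred (Atom → Fin n) 0ℓ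
    realizes      : ∀ {k} (p : Fin k → Atom) → Injective _≡_ _≡_ p →
                    (x : Fin k → Fin n) →
                    ∃ λ v → v ∈ Valuation × (∀ i → v (p i) ≡ x i)

  eval  : (Atom → Fin n) → Formula L → Fin n
  evals : ∀ {k} → (Atom → Fin n) → Vec (Formula L) k → Vec (Fin n) k
  eval v (atom p)   = v p
  eval v (app c As) = truthFunction c (evals v As)
  evals v []        = []
  evals v (A ∷ As)  = eval v A ∷ evals v As

  image : (Atom → Fin n) → Pred (Formula L) 0ℓ → Pred (Fin n) 0ℓ
  image v Γ x = ∃ λ A → A ∈ Γ × eval v A ≡ x

  ConstantExpressive : Set
  ConstantExpressive =
    (x : Fin n) → ∃ λ A → ∀ v → v ∈ Valuation → eval v A ≡ x

  consequence : TruthRelation n → Rel (Pred (Formula L) 0ℓ) 0ℓ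
  consequence _⊨_ Γ Δ = ∀ v → v ∈ Valuation → image v Γ ⊨ image v Δ

open Semantics public using (ConstantExpressive; consequence)

-- The language with one fresh binary connective, `nothing`.
addBinary : Language → Language
addBinary L = record
  { Atom       = Atom
  ; Connective = Maybe Connective
  ; arity      = maybe′ arity 2
  } where open Language L

interpretBinary : ∀ {L n} → (Fin n → Fin n → Fin n) → Semantics L n → Semantics (addBinary L) n
interpretBinary f S = record
  { truthFunction = λ where
      (just c) xs          → truthFunction c xs
      nothing (x ∷ y ∷ []) → f x y
  ; Valuation     = Valuation
  ; realizes      = realizes
  } where open Semantics S

record IsGConjunction {F : Set} (_⊢_ : Rel (Pred F 0ℓ) 0ℓ) (_∧_ : F → F → F) : Set₁ where
  field
    premise    : ∀ Γ Δ A B →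
                 ((Γ ∪ ｛ A ∧ B ｝) ⊢ Δ) ⇔ ((Γ ∪ (｛ A ｝ ∪ ｛ B ｝)) ⊢ Δ)
    conclusion : ∀ Γ Δ A B →
                 (Γ ⊢ (｛ A ∧ B ｝ ∪ Δ)) ⇔ ((Γ ⊢ (｛ A ｝ ∪ Δ)) × (Γ ⊢ (｛ B ｝ ∪ Δ)))

-- "Admits" asks for a truth function: the given language need not already
-- contain a suitable connective, so it is extended by one interpreted by f,
-- and the rules range over all formulas of the extended language.
AdmitsGConjunction : ∀ {L n} → Semantics L n → TruthRelation n → Set₁
AdmitsGConjunction {L} {n} S _⊨_ =
  Σ (Fin n → Fin n → Fin n) λ f →
    IsGConjunction (consequence (interpretBinary f S) _⊨_)
                   (λ A B → app nothing (A ∷ B ∷ []))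

{-# OPTIONS --safe #-}

-- Order pairs of designated sets by (Dₚ , D꜀) ≼ (Eₚ , E꜀) iff Dₚ ⊆ Eₚ and
-- E꜀ ⊆ D꜀.  Testing on γ = Dₚ and δ = V ∖ D꜀ shows that an intersection of
-- mixed relations is included in mixed (Dₚ , D꜀) iff one of its members lies
-- ≼-above (Dₚ , D꜀).  Hence the minimal representations are the antichains
-- without repetition, and the pairs of such a representation occur in every
-- representation of the same relation; so compatibility passes from any
-- representation to the minimal ones.  For a pair (Dₚ , D꜀) of an antichain the
-- same test, with truth values added to γ or to δ, detects membership of these
-- values in Dₚ or in D꜀; as every value is named by a formula, the rules of a
-- G-conjunction force its truth function to witness compatibility.
module Submission where

open import Defs
open import Level using (0ℓ)
open import Data.Empty using (⊥-elim)
open import Data.Fin.Base using (Fin; zero; suc)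
open import Data.Fin.Properties using (any?; injective⇒≤; _≟_)
open import Data.Fin.Subset using (Subset) renaming (_∈_ to _∈ₛ_; _∉_ to _∉ₛ_; _⊆_ to _⊆ₛ_)
open import Data.Fin.Subset.Properties using (_∈?_; _⊆?_; ⊆-refl; ⊆-trans; ⊆-antisym)
open import Data.List.Base using (List; []; _∷_; concatMap; length; lookup; removeAt)
open import Data.List.NonEmpty.Base using (toList; _∷_)
open import Data.List.Membership.Propositional using (find; lose) renaming (_∈_ to _∈ₗ_)
open import Data.List.Membership.Propositional.Properties using (∈-lookup)
open import Data.List.Properties using (length-removeAt′)
open import Data.List.Relation.Binary.Subset.Propositional using () renaming (_⊆_ to _⊆ₗ_)
open import Data.List.Relation.Binary.Subset.Propositional.Properties
  using (All-resp-⊇; concatMap⁺)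
open import Data.List.Relation.Unary.All as All using (All; []; _∷_)
open import Data.List.Relation.Unary.Any as Any using (Any; here; there; index)
open import Data.List.Relation.Unary.Any.Properties using (lookup-index)
open import Data.Maybe.Base using (just; nothing)
open import Data.Nat.Base using (ℕ; _≤_; _<_)
open import Data.Nat.Induction using (<-wellFounded)
open import Data.Nat.Properties using (≤⇒≯; ≤-reflexive)
open import Data.Product.Base using (∃; _×_; _,_; proj₁; proj₂; map₂)
open import Data.Product.Function.NonDependent.Propositional using (_×-⇔_)
open import Data.Sum.Base using (inj₁; inj₂; [_,_]′)
open import Data.Vec.Base using (Vec; []; _∷_)
open import Function.Base using (id; _∘_)
open import Function.Bundles using (_⇔_; mk⇔; Equivalence)
open import Function.Properties.Equivalence using () renaming (trans to ⇔-trans; sym to ⇔-sym)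
open import Induction.WellFounded using (Acc; acc)
open import Relation.Binary.PropositionalEquality.Core
  using (_≡_; _≢_; refl; sym; trans; cong; cong₂; subst)
open import Relation.Nullary.Decidable
  using (Dec; yes; no; _×-dec_; ¬?; decidable-stable)
open import Relation.Nullary.Negation using (¬_; contradiction)
open import Relation.Unary using (Pred; _∈_; _⊆_; _≬_; _∪_; ｛_｝; _≐_)

open Equivalence using (to; from)
open Representation using (pairs; designated; represents)

private variable
  n : ℕ
  L : Language
  p q : Subset n × Subset n
  ps qs : List (Subset n × Subset n)
  γ γ′ δ δ′ : Pred (Fin n) 0ℓ

-- Deleting one position of a list

removeAt-⊆ : ∀ {A : Set} (xs : List A) i → removeAt xs i ⊆ₗ xs
removeAt-⊆ (x ∷ xs) zero    y∈         = there y∈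
removeAt-⊆ (x ∷ xs) (suc i) (here eq)  = here eq
removeAt-⊆ (x ∷ xs) (suc i) (there y∈) = there (removeAt-⊆ xs i y∈)

∈-removeAt : ∀ {A : Set} (xs : List A) i j → i ≢ j → lookup xs j ∈ₗ removeAt xs i
∈-removeAt (x ∷ xs) zero    zero    i≢j = contradiction refl i≢j
∈-removeAt (x ∷ xs) zero    (suc j) i≢j = ∈-lookup j
∈-removeAt (x ∷ xs) (suc i) zero    i≢j = here refl
∈-removeAt (x ∷ xs) (suc i) (suc j) i≢j = there (∈-removeAt xs i j (i≢j ∘ cong suc))

nonEmpty : ∀ {A : Set} {P : A → Set} {xs : List A} → Any P xs → ∃ λ ys → toList ys ≡ xs
nonEmpty {xs = x ∷ xs} _ = (x ∷ xs) , refl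

-- The order on pairs of designated sets

infix 4 _≼_ _≼?_

_≼_ : Subset n × Subset n → Subset n × Subset n → Set
(Dₚ , D꜀) ≼ (Eₚ , E꜀) = Dₚ ⊆ₛ Eₚ × E꜀ ⊆ₛ D꜀

_≼?_ : (p q : Subset n × Subset n) → Dec (p ≼ q)
(Dₚ , D꜀) ≼? (Eₚ , E꜀) = (Dₚ ⊆? Eₚ) ×-dec (E꜀ ⊆? D꜀)

≼-refl : p ≼ p
≼-refl = ⊆-refl , ⊆-refl

≼-trans : ∀ {p q r : Subset n × Subset n} → p ≼ q → q ≼ r → p ≼ r
≼-trans (a , b) (c , d) = ⊆-trans a c , ⊆-trans d b

≼-antisym : p ≼ q → q ≼ p → p ≡ q
≼-antisym (a , b) (c , d) = cong₂ _,_ (⊆-antisym a c) (⊆-antisym d b)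

mixed-mono : γ ⊆ γ′ → δ ⊆ δ′ → mixed p γ δ → mixed p γ′ δ′
mixed-mono γ⊆γ′ δ⊆δ′ m γ′⊆ = map₂ (λ (d , e) → δ⊆δ′ d , e) (m (γ′⊆ ∘ γ⊆γ′))

≼⇒mixed : p ≼ q → mixed q γ δ → mixed p γ δ
≼⇒mixed (Dₚ⊆Eₚ , E꜀⊆D꜀) m γ⊆ = map₂ (map₂ E꜀⊆D꜀) (m (Dₚ⊆Eₚ ∘ γ⊆))

-- The search is constructive because the carrier is finite and membership decidable. The conjuncts
-- are ordered so that the result is an overlap `≬` of the complement of `E` with `D`.
⊈⇒∃ : {D E : Subset n} → ¬ D ⊆ₛ E → ∃ λ x → x ∉ₛ E × x ∈ₛ D
⊈⇒∃ {D = D} {E} D⊈E with any? (λ x → ¬? (x ∈? E) ×-dec (x ∈? D))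
... | yes w = w
... | no ¬w = contradiction
  (λ {x} x∈D → decidable-stable (x ∈? E) (λ x∉E → ¬w (x , x∉E , x∈D))) D⊈E

-- The antecedent of `mixed q` supplies the first half of `p ≼ q`, so the second half must fail, and
-- a value witnessing the failure is the required overlap.
separates : ∀ (p q : Subset n × Subset n) → ¬ p ≼ q →
            mixed q (_∈ₛ proj₁ p) (_∉ₛ proj₂ p)
separates p q p⋠q Dₚ⊆Eₚ = ⊈⇒∃ (λ E꜀⊆D꜀ → p⋠q ((λ {x} → Dₚ⊆Eₚ {x}) , λ {x} → E꜀⊆D꜀ {x}))

-- If no `q` lay above `p`, every `mixed q` would hold at the test sets of `separates`, where
-- `mixed p` demands a value both outside and inside its conclusion set.
dominated : ∀ (p : Subset n × Subset n) qs →
            (∀ γ δ → All (λ q → mixed q γ δ) qs → mixed p γ δ) → Any (p ≼_) qs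
dominated p qs ⋂⊆mixed with Any.any? (p ≼?_) qs
... | yes p≼ = p≼
... | no p⋠  =
  let x , x∉ , x∈ = ⋂⊆mixed (_∈ₛ proj₁ p) (_∉ₛ proj₂ p)
                      (All.tabulate λ {q} q∈ → separates p q (p⋠ ∘ lose q∈)) id
  in contradiction x∈ x∉

-- Irredundant lists of pairs

-- Comparing positions instead of pairs excludes repetitions together with strict comparabilities.
Irredundant : List (Subset n × Subset n) → Set
Irredundant ps = ∀ i j → lookup ps i ≼ lookup ps j → i ≡ j

irredundant-≡ : Irredundant ps → p ∈ₗ ps → q ∈ₗ ps → p ≼ q → p ≡ q
irredundant-≡ {ps = ps} irr p∈ q∈ p≼q =
  trans (lookup-index p∈) (trans (cong (lookup ps) (irr _ _ index≼)) (sym (lookup-index q∈)))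
  where
  index≼ : lookup ps (index p∈) ≼ lookup ps (index q∈)
  index≼ rewrite sym (lookup-index p∈) | sym (lookup-index q∈) = p≼q

Redundancy : List (Subset n × Subset n) → Set
Redundancy ps = ∃ λ i → ∃ λ j → i ≢ j × lookup ps i ≼ lookup ps j

redundancy? : (ps : List (Subset n × Subset n)) → Dec (Redundancy ps)
redundancy? ps = any? λ i → any? λ j → ¬? (i ≟ j) ×-dec (lookup ps i ≼? lookup ps j)

¬redundancy⇒irredundant : ¬ Redundancy ps → Irredundant ps
¬redundancy⇒irredundant ¬red i j i≼j =
  decidable-stable (i ≟ j) (λ i≢j → ¬red (i , j , i≢j , i≼j))

-- The deleted pair is dominated by the one at `j`, which survives since `i ≢ j`; every other
-- position survives and dominates itself.
removeAt-dominates : ∀ (ps : List (Subset n × Subset n)) {i j} → i ≢ j →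
                     lookup ps i ≼ lookup ps j →
                     All (λ p → Any (p ≼_) (removeAt ps i)) ps
removeAt-dominates ps {i} {j} i≢j i≼j = All.tabulate λ p∈ps →
  subst (λ p → Any (p ≼_) (removeAt ps i)) (sym (lookup-index p∈ps)) (at (index p∈ps))
  where
  at : ∀ k → Any (lookup ps k ≼_) (removeAt ps i)
  at k with i ≟ k
  ... | yes refl = lose (∈-removeAt ps i j i≢j) i≼j
  ... | no  i≢k  = lose (∈-removeAt ps i k i≢k) ≼-refl

-- An irredundant list embeds in any list it is equivalent to: a pair is
-- dominated in the other list by one which is in turn dominated by that pair.
irredundant-length : Irredundant ps → All (λ p → Any (p ≼_) qs) ps →
                     All (λ q → Any (q ≼_) ps) qs → length ps ≤ length qs
irredundant-length {ps = ps} {qs = qs} irr ps≼qs qs≼ps = injective⇒≤ embed-injective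
  where
  embed∈ : ∀ i → Any (lookup ps i ≼_) qs
  embed∈ i = All.lookup ps≼qs (∈-lookup i)

  embed : Fin (length ps) → Fin (length qs)
  embed i = index (embed∈ i)

  above : ∀ i → lookup ps i ≼ lookup qs (embed i)
  above i = lookup-index (embed∈ i)

  return : ∀ j → ∃ λ i → lookup qs j ≼ lookup ps i
  return j = let back = All.lookup qs≼ps (∈-lookup j) in index back , lookup-index back

  embed-injective : ∀ {i j} → embed i ≡ embed j → i ≡ j
  embed-injective {i} {j} eq =
    let k , ≼k = return (embed i)
        i≡k = irr i k (≼-trans (above i) ≼k)
        j≡k = irr j k (≼-trans (above j) (subst (λ m → lookup qs m ≼ lookup ps k) eq ≼k))
    in trans i≡k (sym j≡k)

irredundant-⊆ : Irredundant ps → All (λ p → Any (p ≼_) qs) ps →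
                All (λ q → Any (q ≼_) ps) qs → ps ⊆ₗ qs
irredundant-⊆ {qs = qs} irr ps≼qs qs≼ps p∈ps
  with q , q∈qs , p≼q ← find (All.lookup ps≼qs p∈ps)
  with r , r∈ps , q≼r ← find (All.lookup qs≼ps q∈qs)
  with refl ← irredundant-≡ irr p∈ps r∈ps (≼-trans p≼q q≼r)
  = subst (_∈ₗ qs) (≼-antisym q≼r p≼q) q∈qs

-- Minimal representations

module _ {𝟏 𝟎 : Fin n} {_⊨_ : TruthRelation n} where

  pairList : Representation 𝟏 𝟎 _⊨_ → List (Subset n × Subset n)
  pairList R = toList (pairs R)

  -- Both lists define the same `⊨`, so the intersection over `R′` lies in each member of `R`, and
  -- `dominated` applies.
  equivalent : (R R′ : Representation 𝟏 𝟎 _⊨_) →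
               All (λ p → Any (p ≼_) (pairList R′)) (pairList R)
  equivalent R R′ = All.tabulate λ {p} p∈ → dominated p (pairList R′) λ γ δ all →
    All.lookup (to (represents R γ δ) (from (represents R′ γ δ) all)) p∈

  restrict : (R : Representation 𝟏 𝟎 _⊨_) → qs ⊆ₗ pairList R →
             All (λ p → Any (p ≼_) qs) (pairList R) →
             ∃ λ (R′ : Representation 𝟏 𝟎 _⊨_) → pairList R′ ≡ qs
  -- The first pair of `R` has a dominating pair in `qs`, so `qs` is nonempty.
  restrict R qs⊆ R≼qs with qs⁺ , refl ← nonEmpty (All.head R≼qs) = record
    { pairs      = qs⁺
    ; designated = All-resp-⊇ qs⊆ (designated R)
    ; represents = λ γ δ → ⇔-trans (represents R γ δ) (mk⇔ (All-resp-⊇ qs⊆)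
        λ all → All.map (λ p≼ → let q , q∈ , p≼q = find p≼
                                in ≼⇒mixed {γ = γ} {δ} p≼q (All.lookup all q∈)) R≼qs)
    } , refl

  shorten : (R : Representation 𝟏 𝟎 _⊨_) → Redundancy (pairList R) →
            ∃ λ (R′ : Representation 𝟏 𝟎 _⊨_) → size R′ < size R
  shorten R (i , j , i≢j , i≼j)
    with R′ , eq ← restrict R (removeAt-⊆ (pairList R) i) (removeAt-dominates _ i≢j i≼j)
    = R′ , ≤-reflexive (trans (cong (ℕ.suc ∘ length) eq) (sym (length-removeAt′ (pairList R) i)))

  minimal⇒irredundant : (R : Representation 𝟏 𝟎 _⊨_) → Minimal 𝟏 𝟎 R → Irredundant (pairList R)
  minimal⇒irredundant R min = ¬redundancy⇒irredundant λ red →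
    let R′ , shorter = shorten R red in ≤⇒≯ (min R′) shorter

  irredundant⇒minimal : (R : Representation 𝟏 𝟎 _⊨_) → Irredundant (pairList R) → Minimal 𝟏 𝟎 R
  irredundant⇒minimal R irr R′ = irredundant-length irr (equivalent R R′) (equivalent R′ R)

  -- Minimality quantifies over all representations and is not searched for directly: redundant
  -- pairs are dropped until none is left, and irredundance implies minimality.
  minimalRepresentation : Representation 𝟏 𝟎 _⊨_ → ∃ λ (R : Representation 𝟏 𝟎 _⊨_) → Minimal 𝟏 𝟎 R
  minimalRepresentation R = go R (<-wellFounded _)
    where
    go : ∀ R → Acc _<_ (size R) → ∃ (Minimal 𝟏 𝟎)
    go R (acc rs) with redundancy? (pairList R)
    ... | no ¬red = R , irredundant⇒minimal R (¬redundancy⇒irredundant ¬red)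
    ... | yes red = let R′ , shorter = shorten R red in go R′ (rs shorter)

  minimal-compatible : (R R′ : Representation 𝟏 𝟎 _⊨_) → Minimal 𝟏 𝟎 R →
                       ConjunctionCompatible (sets R′) → ConjunctionCompatible (sets R)
  minimal-compatible R R′ min comp x y =
    map₂ (All-resp-⊇ (concatMap⁺ (λ (Dₚ , D꜀) → Dₚ ∷ D꜀ ∷ []) R⊆R′)) (comp x y)
    where
    R⊆R′ : pairList R ⊆ₗ pairList R′
    R⊆R′ = irredundant-⊆ (minimal⇒irredundant R min) (equivalent R R′) (equivalent R′ R)

-- Conjunction at the level of truth values

-- An intermediate notion: the rules of a G-conjunction with formulas replaced by their values, free
-- of syntax and valuations.
record IsTruthConjunction (_⊨_ : TruthRelation n) (f : Fin n → Fin n → Fin n) : Set₁ where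
  field
    premise    : ∀ γ δ x y → ((γ ∪ ｛ f x y ｝) ⊨ δ) ⇔ ((γ ∪ (｛ x ｝ ∪ ｛ y ｝)) ⊨ δ)
    conclusion : ∀ γ δ x y →
                 (γ ⊨ (｛ f x y ｝ ∪ δ)) ⇔ ((γ ⊨ (｛ x ｝ ∪ δ)) × (γ ⊨ (｛ y ｝ ∪ δ)))

components : List (Subset n × Subset n) → List (Subset n)
components = concatMap (λ (Dₚ , D꜀) → Dₚ ∷ D꜀ ∷ [])

components⁺ : ∀ {P : Pred (Subset n) 0ℓ} →
              All (λ (Dₚ , D꜀) → P Dₚ × P D꜀) ps → All P (components ps)
components⁺ []                = []
components⁺ ((a , b) ∷ rest) = a ∷ b ∷ components⁺ rest

components⁻ : ∀ {P : Pred (Subset n) 0ℓ} ps →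
              All P (components ps) → All (λ (Dₚ , D꜀) → P Dₚ × P D꜀) ps
components⁻ []       []             = []
components⁻ (_ ∷ ps) (a ∷ b ∷ rest) = (a , b) ∷ components⁻ ps rest

module _ {x y z : Fin n} where

  mixed-premise : ∀ p → z ∈ₛ proj₁ p ⇔ (x ∈ₛ proj₁ p × y ∈ₛ proj₁ p) →
                  mixed p (γ ∪ ｛ z ｝) δ ⇔ mixed p (γ ∪ (｛ x ｝ ∪ ｛ y ｝)) δ
  mixed-premise p h = mk⇔
    (λ m ⊆Dₚ → m λ where
      (inj₁ a)    → ⊆Dₚ (inj₁ a)
      (inj₂ refl) → from h (⊆Dₚ (inj₂ (inj₁ refl)) , ⊆Dₚ (inj₂ (inj₂ refl))))
    (λ m ⊆Dₚ → m λ where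
      (inj₁ a)           → ⊆Dₚ (inj₁ a)
      (inj₂ (inj₁ refl)) → proj₁ (to h (⊆Dₚ (inj₂ refl)))
      (inj₂ (inj₂ refl)) → proj₂ (to h (⊆Dₚ (inj₂ refl))))

  ∪-≬-conjunction : ∀ {D : Subset n} → z ∈ₛ D ⇔ (x ∈ₛ D × y ∈ₛ D) →
    ((｛ z ｝ ∪ δ) ≬ (_∈ₛ D)) ⇔ (((｛ x ｝ ∪ δ) ≬ (_∈ₛ D)) × ((｛ y ｝ ∪ δ) ≬ (_∈ₛ D)))
  ∪-≬-conjunction h = mk⇔
    (λ where
      (_ , inj₁ refl , z∈) → (x , inj₁ refl , proj₁ (to h z∈)) , (y , inj₁ refl , proj₂ (to h z∈))
      (w , inj₂ d , w∈)    → (w , inj₂ d , w∈) , (w , inj₂ d , w∈))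
    (λ where
      -- A witness from `δ` on either side serves as it is; only when both witnesses are `x` and `y`
      -- themselves is `z` needed.
      ((w , inj₂ d , w∈) , _)                        → w , inj₂ d , w∈
      (_ , (w , inj₂ d , w∈))                        → w , inj₂ d , w∈
      ((_ , inj₁ refl , x∈) , (_ , inj₁ refl , y∈)) → z , inj₁ refl , from h (x∈ , y∈))

module _ {𝟏 𝟎 : Fin n} {_⊨_ : TruthRelation n} (R : Representation 𝟏 𝟎 _⊨_) where

  -- Each rule is checked one mixed relation at a time: the premise rule uses the condition on `Dₚ`,
  -- the conclusion rule the one on `D꜀`.
  compatible⇒truthConjunction : ConjunctionCompatible (sets R) → ∃ (IsTruthConjunction _⊨_)
  compatible⇒truthConjunction comp = (λ x y → proj₁ (comp x y)) , record
    { premise = λ γ δ x y →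
        ⇔-trans (represents R _ _) (⇔-trans
          (mk⇔ (λ all → All.zipWith (λ {p} ((h , _) , m) → to (mixed-premise {γ = γ} {δ} p h) m) (at x y , all))
               (λ all → All.zipWith (λ {p} ((h , _) , m) → from (mixed-premise {γ = γ} {δ} p h) m) (at x y , all)))
          (⇔-sym (represents R _ _)))
    ; conclusion = λ γ δ x y →
        ⇔-trans (represents R _ _) (⇔-trans
          (mk⇔ (λ all → All.zipWith (λ ((_ , h) , m) γ⊆ → proj₁ (to (∪-≬-conjunction {δ = δ} h) (m γ⊆))) (at x y , all)
                      , All.zipWith (λ ((_ , h) , m) γ⊆ → proj₂ (to (∪-≬-conjunction {δ = δ} h) (m γ⊆))) (at x y , all))
               (λ (all₁ , all₂) → All.zipWith
                 (λ ((_ , h) , m₁ , m₂) γ⊆ → from (∪-≬-conjunction {δ = δ} h) (m₁ γ⊆ , m₂ γ⊆))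
                 (at x y , All.zip (all₁ , all₂))))
          (⇔-sym (represents R _ _ ×-⇔ represents R _ _)))
    }
    where at = λ x y → components⁻ (pairList R) (proj₂ (comp x y))

  -- Tests that isolate one pair of an irredundant representation

  module _ (irr : Irredundant (pairList R)) where

    -- By `separates`, every other pair holds at these sets whatever `γ` is. At `p` itself the
    -- conclusion cannot be met, so the relation holds only if the premise fails.
    premise-test : ∀ {p} → p ∈ₗ pairList R → ∀ γ →
                   (((_∈ₛ proj₁ p) ∪ γ) ⊨ (_∉ₛ proj₂ p)) ⇔ (¬ γ ⊆ (_∈ₛ proj₁ p))
    premise-test {p} p∈ γ = ⇔-trans (represents R _ _) (mk⇔
      (λ all → refutes (All.lookup all p∈))
      (λ γ⊈ → All.tabulate (holds γ⊈)))
      where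
      refutes : mixed p ((_∈ₛ proj₁ p) ∪ γ) (_∉ₛ proj₂ p) → ¬ γ ⊆ (_∈ₛ proj₁ p)
      refutes m γ⊆ = let _ , x∉ , x∈ = m [ id , γ⊆ ]′ in x∉ x∈

      holds : ¬ γ ⊆ (_∈ₛ proj₁ p) → ∀ {q} → q ∈ₗ pairList R →
              mixed q ((_∈ₛ proj₁ p) ∪ γ) (_∉ₛ proj₂ p)
      holds γ⊈ {q} q∈ ⊆Eₚ with p ≼? q
      ... | no p⋠q = separates p q p⋠q (⊆Eₚ ∘ inj₁)
      ... | yes p≼q with refl ← irredundant-≡ irr p∈ q∈ p≼q = ⊥-elim (γ⊈ (⊆Eₚ ∘ inj₂))

    -- Again only `p` matters: its premise is satisfied, and `z` is the only value that can meet its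
    -- conclusion.
    conclusion-test : ∀ {p} → p ∈ₗ pairList R → ∀ z →
                      ((_∈ₛ proj₁ p) ⊨ (｛ z ｝ ∪ (_∉ₛ proj₂ p))) ⇔ z ∈ₛ proj₂ p
    conclusion-test {p} p∈ z = ⇔-trans (represents R _ _) (mk⇔
      (λ all → member (All.lookup all p∈ id))
      (λ z∈ → All.tabulate (holds z∈)))
      where
      member : (｛ z ｝ ∪ (_∉ₛ proj₂ p)) ≬ (_∈ₛ proj₂ p) → z ∈ₛ proj₂ p
      member (_ , inj₁ refl , z∈) = z∈
      member (_ , inj₂ x∉ , x∈)   = contradiction x∈ x∉

      holds : z ∈ₛ proj₂ p → ∀ {q} → q ∈ₗ pairList R →
              mixed q (_∈ₛ proj₁ p) (｛ z ｝ ∪ (_∉ₛ proj₂ p))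
      holds z∈ {q} q∈ ⊆Eₚ with p ≼? q
      ... | no p⋠q = let x , x∉ , x∈ = separates p q p⋠q ⊆Eₚ in x , inj₂ x∉ , x∈
      ... | yes p≼q with refl ← irredundant-≡ irr p∈ q∈ p≼q = z , inj₁ refl , z∈

    truthConjunction⇒compatible : ∀ {f} → IsTruthConjunction _⊨_ f →
                                  ConjunctionCompatible (sets R)
    truthConjunction⇒compatible {f} conj x y =
      f x y , components⁺ (All.tabulate λ p∈ → premise-side p∈ , conclusion-side p∈)
      where
      open IsTruthConjunction conj

      conclusion-side : ∀ {p} → p ∈ₗ pairList R →
                        f x y ∈ₛ proj₂ p ⇔ (x ∈ₛ proj₂ p × y ∈ₛ proj₂ p)
      conclusion-side p∈ = ⇔-trans (⇔-sym (conclusion-test p∈ (f x y)))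
        (⇔-trans (conclusion _ _ x y) (conclusion-test p∈ x ×-⇔ conclusion-test p∈ y))

      premise-side : ∀ {p} → p ∈ₗ pairList R →
                     f x y ∈ₛ proj₁ p ⇔ (x ∈ₛ proj₁ p × y ∈ₛ proj₁ p)
      -- `tests` relates only failures of inclusion, so each direction argues by contradiction,
      -- which decidable membership permits.
      premise-side {Dₚ , _} p∈ = mk⇔
        (λ z∈ → decidable-stable ((x ∈? Dₚ) ×-dec (y ∈? Dₚ)) λ ¬xy →
          from tests (λ ⊆Dₚ → ¬xy (⊆Dₚ (inj₁ refl) , ⊆Dₚ (inj₂ refl))) λ { refl → z∈ })
        (λ (x∈ , y∈) → decidable-stable (f x y ∈? Dₚ) λ z∉ →
          to tests (λ ⊆Dₚ → z∉ (⊆Dₚ refl)) λ { (inj₁ refl) → x∈ ; (inj₂ refl) → y∈ })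
        where
        tests : (¬ ｛ f x y ｝ ⊆ (_∈ₛ Dₚ)) ⇔ (¬ (｛ x ｝ ∪ ｛ y ｝) ⊆ (_∈ₛ Dₚ))
        tests = ⇔-trans (⇔-sym (premise-test p∈ _)) (⇔-trans (premise _ _ x y) (premise-test p∈ _))

  -- An arbitrary relation on predicates need not respect `≐`; this one does because each mixed
  -- relation is monotone in both arguments.
  ⊨-cong : γ ≐ γ′ → δ ≐ δ′ → (γ ⊨ δ) ⇔ (γ′ ⊨ δ′)
  ⊨-cong {γ = γ} {γ′} {δ} {δ′} (γ⊆ , γ⊇) (δ⊆ , δ⊇) = ⇔-trans (represents R _ _) (⇔-trans
    (mk⇔ (All.map (λ {p} → mixed-mono {p = p} γ⊆ δ⊆)) (All.map (λ {p} → mixed-mono {p = p} γ⊇ δ⊇)))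
    (⇔-sym (represents R _ _)))

-- Formulas of the extended language

weaken  : Formula L → Formula (addBinary L)
weakens : ∀ {k} → Vec (Formula L) k → Vec (Formula (addBinary L)) k
weaken (atom a)   = atom a
weaken (app c As) = app (just c) (weakens As)
weakens []        = []
weakens (A ∷ As)  = weaken A ∷ weakens As

module _ (S : Semantics L n) (f : Fin n → Fin n → Fin n) where
  open Semantics using (truthFunction; eval; evals)

  S∧ : Semantics (addBinary L) n
  S∧ = interpretBinary f S

  eval-weaken  : ∀ v A → eval S∧ v (weaken A) ≡ eval S v A
  evals-weaken : ∀ v {k} (As : Vec (Formula L) k) → evals S∧ v (weakens As) ≡ evals S v As
  eval-weaken v (atom a)   = refl
  eval-weaken v (app c As) = cong (truthFunction S c) (evals-weaken v As)
  evals-weaken v []        = refl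
  evals-weaken v (A ∷ As)  = cong₂ _∷_ (eval-weaken v A) (evals-weaken v As)

-- Images of sets of formulas

module _ (S : Semantics L n) where
  open Semantics S using (Valuation; eval; image; realizes)

  image-∪ : ∀ {v Γ Δ} → image v Γ ≐ γ → image v Δ ≐ δ → image v (Γ ∪ Δ) ≐ (γ ∪ δ)
  image-∪ (Γ⊆ , Γ⊇) (Δ⊆ , Δ⊇) =
    (λ where
      (A , inj₁ A∈ , eq) → inj₁ (Γ⊆ (A , A∈ , eq))
      (A , inj₂ A∈ , eq) → inj₂ (Δ⊆ (A , A∈ , eq))) ,
    (λ where
      (inj₁ x∈) → let A , A∈ , eq = Γ⊇ x∈ in A , inj₁ A∈ , eq
      (inj₂ x∈) → let A , A∈ , eq = Δ⊇ x∈ in A , inj₂ A∈ , eq)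

  image-｛｝ : ∀ {v A x} → eval v A ≡ x → image v ｛ A ｝ ≐ ｛ x ｝
  image-｛｝ refl = (λ { (_ , refl , eq) → eq }) , (λ eq → _ , refl , eq)

  -- The empty assignment is realized. Without a valuation `consequence` would hold vacuously and
  -- carry no information about `⊨`.
  inhabited : ∃ λ v → v ∈ Valuation
  inhabited = let v , v∈ , _ = realizes {0} (λ ()) (λ { {()} }) (λ ()) in v , v∈

-- Transfer between truth values and formulas

module _ {𝟏 𝟎 : Fin n} {_⊨_ : TruthRelation n} (R : Representation 𝟏 𝟎 _⊨_)
         (S : Semantics L n) {f : Fin n → Fin n → Fin n} where
  open Semantics (interpretBinary f S) using (Valuation; eval; image)

  private
    S′ = interpretBinary f S

    ≐-refl : γ ≐ γ
    ≐-refl = id , id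

    _∧_ : Formula (addBinary L) → Formula (addBinary L) → Formula (addBinary L)
    A ∧ B = app nothing (A ∷ B ∷ [])

  truthConjunction⇒G : IsTruthConjunction _⊨_ f → IsGConjunction (consequence S′ _⊨_) _∧_
  truthConjunction⇒G conj = record
    { premise    = λ Γ Δ A B →
        mk⇔ (λ h v v∈ → to (premise-at Γ Δ A B v) (h v v∈))
            (λ h v v∈ → from (premise-at Γ Δ A B v) (h v v∈))
    ; conclusion = λ Γ Δ A B →
        mk⇔ (λ h → (λ v v∈ → proj₁ (to (conclusion-at Γ Δ A B v) (h v v∈))) ,
                   (λ v v∈ → proj₂ (to (conclusion-at Γ Δ A B v) (h v v∈))))
            (λ (h , k) v v∈ → from (conclusion-at Γ Δ A B v) (h v v∈ , k v v∈))
    }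
    where
    open IsTruthConjunction conj

    value : ∀ {v} A → image v ｛ A ｝ ≐ ｛ eval v A ｝
    value _ = image-｛｝ S′ refl

    premise-at : ∀ Γ Δ A B v → (image v (Γ ∪ ｛ A ∧ B ｝) ⊨ image v Δ) ⇔
                               (image v (Γ ∪ (｛ A ｝ ∪ ｛ B ｝)) ⊨ image v Δ)
    premise-at Γ Δ A B v =
      ⇔-trans (⊨-cong R (image-∪ S′ ≐-refl (value (A ∧ B))) ≐-refl)
      (⇔-trans (premise _ _ _ _)
      (⇔-sym (⊨-cong R (image-∪ S′ ≐-refl (image-∪ S′ (value A) (value B))) ≐-refl)))

    conclusion-at : ∀ Γ Δ A B v →
      (image v Γ ⊨ image v (｛ A ∧ B ｝ ∪ Δ)) ⇔
      ((image v Γ ⊨ image v (｛ A ｝ ∪ Δ)) × (image v Γ ⊨ image v (｛ B ｝ ∪ Δ)))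
    conclusion-at Γ Δ A B v =
      ⇔-trans (⊨-cong R ≐-refl (image-∪ S′ (value (A ∧ B)) ≐-refl))
      (⇔-trans (conclusion _ _ _ _)
      (⇔-sym (⊨-cong R ≐-refl (image-∪ S′ (value A) ≐-refl)
          ×-⇔ ⊨-cong R ≐-refl (image-∪ S′ (value B) ≐-refl))))

  -- Naming values by constant formulas turns any `γ` and `δ` into images that are the same under
  -- every valuation, so `consequence` between the names reduces to `γ ⊨ δ`.
  G⇒truthConjunction : ConstantExpressive S → IsGConjunction (consequence S′ _⊨_) _∧_ →
                       IsTruthConjunction _⊨_ f
  G⇒truthConjunction const conj = record
    { premise    = λ γ δ x y →
        ⇔-trans (⇔-sym (consequence⇔ (λ v∈ → image-∪ S′ (image-names v∈) (image-name∧ v∈)) image-names))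
        (⇔-trans (premise (names γ) (names δ) (name x) (name y))
        (consequence⇔ (λ v∈ → image-∪ S′ (image-names v∈)
                                (image-∪ S′ (image-name v∈) (image-name v∈))) image-names))
    ; conclusion = λ γ δ x y →
        ⇔-trans (⇔-sym (consequence⇔ image-names (λ v∈ → image-∪ S′ (image-name∧ v∈) (image-names v∈))))
        (⇔-trans (conclusion (names γ) (names δ) (name x) (name y))
        (consequence⇔ image-names (λ v∈ → image-∪ S′ (image-name v∈) (image-names v∈))
         ×-⇔ consequence⇔ image-names (λ v∈ → image-∪ S′ (image-name v∈) (image-names v∈))))
    }
    where
    open IsGConjunction conj

    name : Fin n → Formula (addBinary L)
    name x = weaken (proj₁ (const x))

    eval-name : ∀ {v} → v ∈ Valuation → ∀ x → eval v (name x) ≡ x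
    eval-name v∈ x = trans (eval-weaken S f _ (proj₁ (const x))) (proj₂ (const x) _ v∈)

    names : Pred (Fin n) 0ℓ → Pred (Formula (addBinary L)) 0ℓ
    names γ A = ∃ λ x → x ∈ γ × name x ≡ A

    image-names : ∀ {v} → v ∈ Valuation → image v (names γ) ≐ γ
    image-names {γ = γ} v∈ =
      (λ { (_ , (x , x∈ , refl) , eq) → subst γ (trans (sym (eval-name v∈ x)) eq) x∈ }) ,
      (λ {x} x∈ → name x , (x , x∈ , refl) , eval-name v∈ x)

    image-name : ∀ {v x} → v ∈ Valuation → image v ｛ name x ｝ ≐ ｛ x ｝
    image-name v∈ = image-｛｝ S′ (eval-name v∈ _)

    image-name∧ : ∀ {v x y} → v ∈ Valuation → image v ｛ name x ∧ name y ｝ ≐ ｛ f x y ｝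
    image-name∧ v∈ = image-｛｝ S′ (cong₂ f (eval-name v∈ _) (eval-name v∈ _))

    consequence⇔ : ∀ {Γ Δ} → (∀ {v} → v ∈ Valuation → image v Γ ≐ γ) →
                   (∀ {v} → v ∈ Valuation → image v Δ ≐ δ) →
                   consequence S′ _⊨_ Γ Δ ⇔ (γ ⊨ δ)
    consequence⇔ Γ≐γ Δ≐δ = mk⇔
      (λ h → let v , v∈ = inhabited S′ in to (⊨-cong R (Γ≐γ v∈) (Δ≐δ v∈)) (h v v∈))
      (λ γ⊨δ v v∈ → from (⊨-cong R (Γ≐γ v∈) (Δ≐δ v∈)) γ⊨δ)

theorem7p4 : ∀ {n} (𝟏 𝟎 : Fin n) → 𝟏 ≢ 𝟎 →
    ∀ (L : Language) (S : Semantics L n) → ConstantExpressive S →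
    ∀ (_⊨_ : TruthRelation n) → IntersectiveMixed 𝟏 𝟎 _⊨_ →
    (AdmitsGConjunction S _⊨_
    ⇔ (∀ (R : Representation 𝟏 𝟎 _⊨_) → Minimal 𝟏 𝟎 R → ConjunctionCompatible (sets R)))
    × ((∀ (R : Representation 𝟏 𝟎 _⊨_) → Minimal 𝟏 𝟎 R → ConjunctionCompatible (sets R))
    ⇔ (∃ λ (R : Representation 𝟏 𝟎 _⊨_) → ConjunctionCompatible (sets R)))
theorem7p4 𝟏 𝟎 _ L S const _⊨_ R₀ =
  mk⇔ (λ (f , conj) R min → truthConjunction⇒compatible R (minimal⇒irredundant R min)
                              (G⇒truthConjunction R S const conj))
      -- A single compatible representation suffices to define the truth function, so this direction
      -- passes through (iii).
      (λ minComp → let R , comp = some minComp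
                       f , conj = compatible⇒truthConjunction R comp
                   in f , truthConjunction⇒G R S conj) ,
  mk⇔ some (λ (R′ , comp) R min → minimal-compatible R R′ min comp)
  where
  -- Condition (ii) is not vacuous: `R₀` can be thinned to a minimal representation.
  some : (∀ R → Minimal 𝟏 𝟎 R → ConjunctionCompatible (sets R)) →
         ∃ λ R → ConjunctionCompatible (sets R)
  some minComp = let R , min = minimalRepresentation R₀ in R , minComp R min
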